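{- Let $n \ge 3$ and let $S$ be a set of transpositions that generates the symmetric group $S_n$. If the girth of the transposition graph $T(S)$ is at least $5$, then the automorphism group of the Cayley graph $\mathrm{Cay}(S_n,S)$ is the semidirect product $R(S_n) \rtimes \mathrm{Aut}(S_n,S)$, where $\mathrm{Aut}(S_n,S)$ is the set of automorphisms of the group $S_n$ that fix $S$ setwise.
   Context: Transposition graph: for a set $S$ of transpositions in $S_n$, $T(S)$ is the simple graph with vertex set $\{1,\ldots,n\}$ in which $i$ and $j$ are adjacent if and only if $(i,j) \in S$. The set $S$ generates $S_n$ if and only if $T(S)$ is connected. Girth: the length of a shortest cycle in a graph; a graph with no cycles (a tree, for instance) has infinite girth, so it satisfies "girth at least 5". Cayley graph: for a group $H$ and a subset $S \subseteq H$ with $1 \notin S = S^{ -1}$, $\mathrm{Cay}(H,S)$ is the simple undirected graph with vertex set $H$ in which $h$ is adjacent to $sh$ for all $h \in H$, $s \in S$. Its automorphism group is the group of all graph automorphisms (adjacency-preserving permutations of the vertex set). $R(H)$ is the right regular representation of $H$, i.e. the group of permutations $x \mapsto xg$ of $H$ ($g \in H$); it is a subgroup of the automorphism group of $\mathrm{Cay}(H,S)$. $\mathrm{Aut}(H,S) := \{\pi \in \mathrm{Aut}(H) : S^{\pi} = S\}$, where $\mathrm{Aut}(H)$ is the group of group automorphisms of $H$; it is a subgroup of the stabilizer of the identity vertex $e$ in the automorphism group of $\mathrm{Cay}(H,S)$. The semidirect product is internal: with $\Gamma = \mathrm{Cay}(S_n,S)$, the statement $\mathrm{Aut}(\Gamma)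 = R(S_n) \rtimes \mathrm{Aut}(S_n,S)$ means that, as subgroups of the group of permutations of the set $S_n$, $R(S_n)$ is normal in $\mathrm{Aut}(\Gamma)$, $R(S_n) \cap \mathrm{Aut}(S_n,S) = 1$, and $\mathrm{Aut}(\Gamma) = R(S_n)\,\mathrm{Aut}(S_n,S)$. -}

module Defs where

open import Level using (Level; _⊔_; suc; 0ℓ)
open import Algebra.Bundles using (Group)
open import Algebra.Morphism.Structures using (IsGroupIsomorphism)
import Algebra.Properties.Group as GroupProperties
open import Data.Fin.Base using (Fin; inject₁; fromℕ)
open import Data.Fin.Permutation using (Permutation′; transpose; _⟨$⟩ʳ_)
open import Data.Fin.Properties using (_≟_)
open import Data.Nat.Base as ℕ using (ℕ; _≤_)
open import Data.Product.Base using (∃; ∃₂; _×_; _,_)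
open import Function.Base using (_∘_)
open import Function.Bundles using (Inverse; _⇔_)
import Function.Construct.Composition as Composition
import Function.Construct.Identity as Identity
import Function.Construct.Symmetry as Symmetry
open import Function.Definitions using (Injective)
open import Relation.Binary.Bundles using (Setoid)
open import Relation.Binary.Core using (Rel)
open import Relation.Binary.Definitions using (Irreflexive; Symmetric; _Respects₂_; _Respects_)
open import Relation.Binary.PropositionalEquality as ≡ using (_≡_; _≢_; refl)
open import Relation.Nullary.Construct.Add.Supremum using (_⁺; [_]; ⊤⁺)
open import Relation.Nullary.Decidable.Core using (Dec; yes; no)
open import Relation.Nullary.Negation using (¬_; contradiction)
open import Relation.Unary using (Pred; Decidable; _⊆_; _≐_)

open import Relation.Binary.Construct.Add.Supremum.NonStrict _≤_ public using () renaming (_≤⁺_ to _≤∞_)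

------------------------------------------------------------------------
-- Groups, subgroups and permutation groups

-- The group of all permutations of a setoid, up to pointwise equality.
-- Permutations act on the right: f ∙ g is "first f, then g".

Sym : ∀ {c ℓ} → Setoid c ℓ → Group (c ⊔ ℓ) (c ⊔ ℓ)
Sym X = record
  { Carrier = Inverse X X
  ; _≈_ = λ f g → ∀ x → to f x ≈ to g x
  ; _∙_ = Composition.inverse
  ; ε = Identity.inverse X
  ; _⁻¹ = Symmetry.inverse
  ; isGroup = record
    { isMonoid = record
      { isSemigroup = record
        { isMagma = record
          { isEquivalence = record
            { refl = λ _ → X.refl
            ; sym = λ p x → X.sym (p x)
            ; trans = λ p q x → X.trans (p x) (q x)
            }
          ; ∙-cong = λ {f} {f′} {g} {g′} p q x →
              X.trans (to-cong g (p x)) (q (to f′ x))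
          }
        ; assoc = λ _ _ _ _ → X.refl
        }
      ; identity = (λ _ _ → X.refl) , (λ _ _ → X.refl)
      }
    ; inverse = (λ f → strictlyInverseˡ f) , (λ f → strictlyInverseʳ f)
    ; ⁻¹-cong = λ {f} {g} p x →
        X.trans (X.sym (strictlyInverseʳ g (from f x)))
          (from-cong g (X.trans (X.sym (p (from f x))) (strictlyInverseˡ f x)))
    }
  }
  where
  module X = Setoid X
  open X using (_≈_)
  open Inverse

module _ {c ℓ} (G : Group c ℓ) where
  open Group G

  record IsSubgroup {p} (P : Pred Carrier p) : Set (c ⊔ ℓ ⊔ p) where
    field
      resp      : P Respects _≈_
      ε-closed  : P ε
      ∙-closed  : ∀ {x y} → P x → P y → P (x ∙ y)
      ⁻¹-closed : ∀ {x} → P x → P (x ⁻¹)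

  record IsNormalSubgroupOf {a p} (A : Pred Carrier a) (N : Pred Carrier p) : Set (c ⊔ ℓ ⊔ a ⊔ p) where
    field
      isSubgroup       : IsSubgroup N
      contained        : N ⊆ A
      conjugate-closed : ∀ {g x} → A g → N x → N (g ⁻¹ ∙ x ∙ g)

  SetProduct : ∀ {p q} → Pred Carrier p → Pred Carrier q → Pred Carrier (c ⊔ ℓ ⊔ p ⊔ q)
  SetProduct P Q x = ∃₂ λ y z → P y × Q z × x ≈ y ∙ z

  record IsInternalSemidirectProduct {a p q} (A : Pred Carrier a) (N : Pred Carrier p) (K : Pred Carrier q) : Set (c ⊔ ℓ ⊔ a ⊔ p ⊔ q) where
    field
      isSubgroup    : IsSubgroup A
      normal        : IsNormalSubgroupOf A N
      complement    : IsSubgroup K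
      complement-⊆  : K ⊆ A
      trivial-∩     : ∀ {x} → N x → K x → x ≈ ε
      factorisation : A ≐ SetProduct N K

  data ⟨_⟩ {p} (P : Pred Carrier p) : Pred Carrier (c ⊔ ℓ ⊔ p) where
    gen    : ∀ {x} → P x → ⟨ P ⟩ x
    unit   : ⟨ P ⟩ ε
    mul    : ∀ {x y} → ⟨ P ⟩ x → ⟨ P ⟩ y → ⟨ P ⟩ (x ∙ y)
    inv    : ∀ {x} → ⟨ P ⟩ x → ⟨ P ⟩ (x ⁻¹)
    resp-≈ : ∀ {x y} → x ≈ y → ⟨ P ⟩ x → ⟨ P ⟩ y

  Generates : ∀ {p} → Pred Carrier p → Set (c ⊔ ℓ ⊔ p)
  Generates P = ∀ x → ⟨ P ⟩ x

  RightRegular : Pred (Inverse setoid setoid) (c ⊔ ℓ)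
  RightRegular f = ∃ λ g → ∀ x → Inverse.to f x ≈ x ∙ g

  Image : ∀ {p} → Inverse setoid setoid → Pred Carrier p → Pred Carrier (c ⊔ ℓ ⊔ p)
  Image f P y = ∃ λ x → P x × y ≈ Inverse.to f x

  AutFixing : ∀ {p} → Pred Carrier p → Pred (Inverse setoid setoid) (c ⊔ ℓ ⊔ p)
  AutFixing P f = IsGroupIsomorphism rawGroup rawGroup (Inverse.to f) × Image f P ≐ P

------------------------------------------------------------------------
-- Graphs

record SimpleGraph {c ℓ} (V : Setoid c ℓ) (e : Level) : Set (c ⊔ ℓ ⊔ suc e) where
  open Setoid V using (Carrier; _≈_)
  field
    Adj        : Rel Carrier e
    Adj-resp   : Adj Respects₂ _≈_
    Adj-sym    : Symmetric Adj
    Adj-irrefl : Irreflexive _≈_ Adj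

module _ {c ℓ e} {V : Setoid c ℓ} (Γ : SimpleGraph V e) where
  open Setoid V using (Carrier; _≈_)
  open SimpleGraph Γ

  Aut : Pred (Inverse V V) (c ⊔ e)
  Aut f = ∀ x y → Adj x y ⇔ Adj (Inverse.to f x) (Inverse.to f y)

  -- A cycle v₀, v₁, …, vₘ of length m + 1 ≥ 3, indexed by its length.

  data Cycle : ℕ → Set (c ⊔ ℓ ⊔ e) where
    cycle : ∀ {m} → 3 ≤ ℕ.suc m →
            (v : Fin (ℕ.suc m) → Carrier) →
            Injective _≡_ _≈_ v →
            (∀ (i : Fin m) → Adj (v (inject₁ i)) (v (Fin.suc i))) →
            Adj (v (fromℕ m)) (v Fin.zero) →
            Cycle (ℕ.suc m)

  -- HasGirth g: the girth is g, where the girth of an acyclic graph is ∞.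

  data HasGirth : ℕ ⁺ → Set (c ⊔ ℓ ⊔ e) where
    finite   : ∀ {g} → Cycle g → (∀ {k} → Cycle k → g ≤ k) → HasGirth [ g ]
    infinite : (∀ {k} → ¬ Cycle k) → HasGirth ⊤⁺

module _ {c ℓ} (G : Group c ℓ) where
  open Group G
  open GroupProperties G

  record ConnectionSet (p : Level) : Set (c ⊔ ℓ ⊔ suc p) where
    field
      member    : Pred Carrier p
      resp      : member Respects _≈_
      ε∉        : ¬ member ε
      ⁻¹-closed : ∀ {s} → member s → member (s ⁻¹)

  Cay : ∀ {p} → ConnectionSet p → SimpleGraph setoid (c ⊔ ℓ ⊔ p)
  Cay S = record
    { Adj = λ h k → ∃ λ s → member s × k ≈ s ∙ h
    ; Adj-resp =
        (λ k≈k′ (s , s∈S , k≈sh) → s , s∈S , trans (sym k≈k′) k≈sh) ,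
        (λ h≈h′ (s , s∈S , k≈sh) → s , s∈S , trans k≈sh (∙-congˡ h≈h′))
    ; Adj-sym = λ {h} (s , s∈S , k≈sh) →
        s ⁻¹ , ⁻¹-closed s∈S ,
        trans (sym (\\-leftDividesʳ s h)) (∙-congˡ (sym k≈sh))
    ; Adj-irrefl = λ {h} h≈k (s , s∈S , k≈sh) →
        ε∉ (resp (identityˡ-unique s h (sym (trans h≈k k≈sh))) s∈S)
    }
    where open ConnectionSet S

------------------------------------------------------------------------
-- The symmetric group and its transpositions

-- Carrier (Sₙ n) is Permutation′ n, and its product and equality are
-- _∘ₚ_ and _≈_ of Data.Fin.Permutation.

Sₙ : ℕ → Group 0ℓ 0ℓ
Sₙ n = Sym (≡.setoid (Fin n))

IsTransposition : ∀ {n} → Pred (Permutation′ n) 0ℓ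
IsTransposition {n} σ = ∃₂ λ i j → i ≢ j × σ ≈ transpose i j
  where open Group (Sₙ n) using (_≈_)

-- Constructively, a subset of the finite set Sₙ is a decidable predicate.

record TranspositionSet (n : ℕ) (p : Level) : Set (suc p) where
  open Group (Sₙ n) using (_≈_)
  field
    member         : Pred (Permutation′ n) p
    resp           : member Respects _≈_
    member?        : Decidable member
    transpositions : member ⊆ IsTransposition

module _ {n : ℕ} where
  open Group (Sₙ n) using (_≈_; _⁻¹; ⁻¹-cong)

  transpose-matchˡ : ∀ (i j : Fin n) → transpose i j ⟨$⟩ʳ i ≡ j
  transpose-matchˡ i j with i ≟ i
  ... | yes _   = refl
  ... | no  i≢i = contradiction refl i≢i

  transpose-matchʳ : ∀ (i j : Fin n) → transpose i j ⟨$⟩ʳ j ≡ i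
  transpose-matchʳ i j with j ≟ i
  ... | yes j≡i = j≡i
  ... | no  _ with j ≟ j
  ...   | yes _   = refl
  ...   | no  j≢j = contradiction refl j≢j

  transpose-mismatch : ∀ (i j : Fin n) {k} → k ≢ i → k ≢ j → transpose i j ⟨$⟩ʳ k ≡ k
  transpose-mismatch i j {k} k≢i k≢j with k ≟ i
  ... | yes k≡i = contradiction k≡i k≢i
  ... | no  _ with k ≟ j
  ...   | yes k≡j = contradiction k≡j k≢j
  ...   | no  _   = refl

  transpose-comm : ∀ i j → transpose i j ≈ transpose j i
  transpose-comm i j k = helper (k ≟ i) (k ≟ j)
    where
    helper : Dec (k ≡ i) → Dec (k ≡ j) → transpose i j ⟨$⟩ʳ k ≡ transpose j i ⟨$⟩ʳ k
    helper (yes refl) _          = ≡.trans (transpose-matchˡ i j) (≡.sym (transpose-matchʳ j i))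
    helper (no _)     (yes refl) = ≡.trans (transpose-matchʳ i j) (≡.sym (transpose-matchˡ j i))
    helper (no k≢i)   (no k≢j)   =
      ≡.trans (transpose-mismatch i j k≢i k≢j) (≡.sym (transpose-mismatch j i k≢j k≢i))

  module _ {p} (S : TranspositionSet n p) where
    open TranspositionSet S

    connectionSet : ConnectionSet (Sₙ n) p
    connectionSet = record
      { member = member
      ; resp = resp
      ; ε∉ = λ ε∈S → let (i , j , i≢j , ε≈ij) = transpositions ε∈S in
          i≢j (≡.trans (ε≈ij i) (transpose-matchˡ i j))
      ; ⁻¹-closed = λ {s} s∈S → let (i , j , _ , s≈ij) = transpositions s∈S in
          resp {s} {s ⁻¹}
            (λ k → ≡.trans (s≈ij k) (≡.trans (transpose-comm i j k)
              (≡.sym (⁻¹-cong {s} {transpose i j} s≈ij k))))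
            s∈S
      }

    transpositionGraph : SimpleGraph (≡.setoid (Fin n)) p
    transpositionGraph = record
      { Adj = λ i j → i ≢ j × member (transpose i j)
      ; Adj-resp = (λ { refl a → a }) , (λ { refl a → a })
      ; Adj-sym = λ {i} {j} (i≢j , ij∈S) → i≢j ∘ ≡.sym , resp (transpose-comm i j) ij∈S
      ; Adj-irrefl = λ i≡j (i≢j , _) → i≢j i≡j
      }

{-# OPTIONS --safe #-}

-- Let f be an automorphism of Cay(Sₙ, S).  The edge with label t at h is mapped
-- to an edge at f h with some label in S.  This label does not change
-- when h is replaced by s h for s ∈ S: if s and t commute, because a path of
-- length two from h to s t h can only be completed to a 4-cycle by interchanging
-- its labels, and if they do not, because the closed walk given by sts = tst is
-- mapped to a closed walk of length six whose consecutive labels do not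
-- commute, and the girth condition forces such labels to alternate.  As S
-- generates Sₙ, the labels do not depend on h at all, which makes
-- x ↦ f x (f 1)⁻¹ a group automorphism preserving S.

module Submission where

open import Defs
open import Algebra.Bundles using (Group)
open import Data.Nat.Base using (ℕ; _≤_)
open import Relation.Nullary.Construct.Add.Supremum using (_⁺; [_])

open import Algebra.Morphism.Structures using (IsGroupIsomorphism)
import Algebra.Properties.Group as GroupProperties
open import Data.Empty using (⊥)
open import Data.Fin.Base using (Fin; zero; suc)
open import Data.Fin.Permutation using (Permutation′; transpose)
open import Data.Fin.Properties using (_≟_; all?; any?)
open import Data.Nat.Base using (s≤s; z≤n)
open import Data.Nat.Properties using (≤-trans)
open import Data.Product.Base using (_×_; _,_; proj₁; proj₂; ∃₂)
open import Data.Sum.Base using (_⊎_; inj₁; inj₂)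
open import Data.Vec.Base using (lookup; []; _∷_)
open import Data.Vec.Relation.Unary.All using ([]; _∷_)
open import Data.Vec.Relation.Unary.AllPairs using ([]; _∷_)
open import Data.Vec.Relation.Unary.Unique.Propositional.Properties using (lookup-injective)
open import Function.Base using (_∘_; id)
open import Function.Bundles using (Inverse; Equivalence; mk⇔)
open import Level using (_⊔_)
open import Relation.Binary.Construct.Add.Supremum.NonStrict _≤_ using () renaming ([_] to [_]≤)
open import Relation.Binary.Definitions using (Decidable)
open import Relation.Binary.PropositionalEquality as ≡ using (_≡_; _≢_; ≢-sym)
import Relation.Binary.Reasoning.Setoid as SetoidReasoning
open import Relation.Nullary.Decidable.Core using (Dec; yes; no; ¬?; _×-dec_; decidable-stable)
open import Relation.Nullary.Negation using (¬_; contradiction)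

-- Cayley graphs of an arbitrary group: automorphisms, translations and edge labels.

module CayleyGraph {c ℓ p} (G : Group c ℓ) (S : ConnectionSet G p) where
  open Group G
  open GroupProperties G
  open ConnectionSet S
  open SimpleGraph (Cay G S) using (Adj; Adj-resp)
  open Inverse using (to; from; to-cong; from-cong; strictlyInverseˡ; strictlyInverseʳ)
  open SetoidReasoning setoid

  module 𝕊 = Group (Sym setoid)

  private
    Perm = Inverse setoid setoid
    A = Aut (Cay G S)
    R = RightRegular G
    K = AutFixing G member

  to-injective : (f : Perm) → ∀ {x y} → to f x ≈ to f y → x ≈ y
  to-injective f {x} {y} eq = begin
    x               ≈⟨ strictlyInverseʳ f x ⟨
    from f (to f x) ≈⟨ from-cong f eq ⟩
    from f (to f y) ≈⟨ strictlyInverseʳ f y ⟩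
    y               ∎

  Adj-respects : ∀ {x x′ y y′} → x ≈ x′ → y ≈ y′ → Adj x y → Adj x′ y′
  Adj-respects p q = proj₂ Adj-resp p ∘ proj₁ Adj-resp q

  Aut-resp : ∀ {f g} → f 𝕊.≈ g → A f → A g
  Aut-resp {f} {g} f≈g Af x y = mk⇔
    (Adj-respects (f≈g x) (f≈g y) ∘ Equivalence.to (Af x y))
    (Equivalence.from (Af x y) ∘ Adj-respects (sym (f≈g x)) (sym (f≈g y)))

  Aut-⁻¹ : ∀ {f} → A f → A (f 𝕊.⁻¹)
  Aut-⁻¹ {f} Af x y = mk⇔
    (Equivalence.from e ∘ Adj-respects (sym (strictlyInverseˡ f x)) (sym (strictlyInverseˡ f y)))
    (Adj-respects (strictlyInverseˡ f x) (strictlyInverseˡ f y) ∘ Equivalence.to e)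
    where e = Af (from f x) (from f y)

  Aut-isSubgroup : IsSubgroup (Sym setoid) A
  Aut-isSubgroup = record
    { resp      = λ {f} {g} → Aut-resp {f} {g}
    ; ε-closed  = λ _ _ → mk⇔ id id
    ; ∙-closed  = λ {f} {g} Af Ag x y → mk⇔
        (Equivalence.to (Ag (to f x) (to f y)) ∘ Equivalence.to (Af x y))
        (Equivalence.from (Af x y) ∘ Equivalence.from (Ag (to f x) (to f y)))
    ; ⁻¹-closed = λ {f} → Aut-⁻¹ {f}
    }

  RightRegular-isSubgroup : IsSubgroup (Sym setoid) R
  RightRegular-isSubgroup = record
    { resp      = λ { f≈g (a , fa) → a , λ x → trans (sym (f≈g x)) (fa x) }
    ; ε-closed  = ε , λ x → sym (identityʳ x)
    ; ∙-closed  = λ { {f} {g} (a , fa) (b , gb) → a ∙ b , λ x →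
        trans (gb (to f x)) (trans (∙-congʳ (fa x)) (assoc x a b)) }
    ; ⁻¹-closed = λ { {f} (a , fa) → a ⁻¹ , λ x →
        x≈z//y _ a _ (trans (sym (fa (from f x))) (strictlyInverseˡ f x)) }
    }

  RightRegular⊆Aut : ∀ {f} → R f → A f
  RightRegular⊆Aut {f} (a , fa) x y = mk⇔
    (λ (s , s∈S , y≈sx) → s , s∈S ,
      trans (fa y) (trans (∙-congʳ y≈sx) (trans (assoc s x a) (∙-congˡ (sym (fa x))))))
    (λ (s , s∈S , fy≈sfx) → s , s∈S , ∙-cancelʳ a y (s ∙ x)
      (trans (sym (fa y)) (trans fy≈sfx (trans (∙-congˡ (fa x)) (sym (assoc s x a))))))

  rightTranslation : Carrier → Perm
  rightTranslation a = record
    { to        = _∙ a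
    ; from      = _// a
    ; to-cong   = ∙-congʳ
    ; from-cong = ∙-congʳ
    ; inverse   = (λ {x} eq → trans (∙-congʳ eq) (//-rightDividesˡ a x))
                , (λ {x} eq → trans (∙-congʳ eq) (//-rightDividesʳ a x))
    }

  -- A minimal form of `AutFixing`: the other laws of a group isomorphism follow from these three
  -- fields. As `reflects` is phrased through `from f`, passing to the inverse permutation merely
  -- exchanges the last two fields.
  record IsFixingAut (f : Perm) : Set (c ⊔ ℓ ⊔ p) where
    field
      homo      : ∀ x y → to f (x ∙ y) ≈ to f x ∙ to f y
      preserves : ∀ {x} → member x → member (to f x)
      reflects  : ∀ {x} → member x → member (from f x)

    ε-homo : to f ε ≈ ε
    ε-homo = identityˡ-unique (to f ε) (to f ε)
      (trans (sym (homo ε ε)) (to-cong f (identityˡ ε)))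

    from-homo : ∀ x y → from f (x ∙ y) ≈ from f x ∙ from f y
    from-homo x y = to-injective f (begin
      to f (from f (x ∙ y))               ≈⟨ strictlyInverseˡ f (x ∙ y) ⟩
      x ∙ y                               ≈⟨ ∙-cong (strictlyInverseˡ f x) (strictlyInverseˡ f y) ⟨
      to f (from f x) ∙ to f (from f y)   ≈⟨ homo (from f x) (from f y) ⟨
      to f (from f x ∙ from f y)          ∎)

  open IsFixingAut

  toAutFixing : ∀ {f} → IsFixingAut f → K f
  toAutFixing {f} F = record
    { isGroupMonomorphism = record
      { isGroupHomomorphism = record
        { isMonoidHomomorphism = record
          { isMagmaHomomorphism = record
            { isRelHomomorphism = record { cong = to-cong f }
            ; homo = homo F
            }
          ; ε-homo = ε-homo F
          }
        ; ⁻¹-homo = λ x → inverseˡ-unique (to f (x ⁻¹)) (to f x)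
            (trans (sym (homo F (x ⁻¹) x)) (trans (to-cong f (inverseˡ x)) (ε-homo F)))
        }
      ; injective = to-injective f
      }
    ; surjective = λ y → from f y , λ z≈ → trans (to-cong f z≈) (strictlyInverseˡ f y)
    }
    , (λ (x , x∈S , y≈fx) → resp (sym y≈fx) (preserves F x∈S))
    , (λ {y} y∈S → from f y , reflects F y∈S , sym (strictlyInverseˡ f y))

  fromAutFixing : ∀ {f} → K f → IsFixingAut f
  fromAutFixing {f} (iso , image⊆ , ⊆image) = record
    { homo      = IsGroupIsomorphism.∙-homo iso
    ; preserves = λ {x} x∈S → image⊆ (x , x∈S , refl)
    ; reflects  = λ {x} x∈S → let (y , y∈S , x≈fy) = ⊆image x∈S in
        resp (sym (trans (from-cong f x≈fy) (strictlyInverseʳ f y))) y∈S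
    }

  AutFixing-isSubgroup : IsSubgroup (Sym setoid) K
  AutFixing-isSubgroup = record
    { resp      = λ {f} {g} f≈g Kf → let F = fromAutFixing {f} Kf in toAutFixing {g} record
        { homo      = λ x y → trans (sym (f≈g (x ∙ y))) (trans (homo F x y) (∙-cong (f≈g x) (f≈g y)))
        ; preserves = λ {x} x∈S → resp (f≈g x) (preserves F x∈S)
        ; reflects  = λ {x} x∈S → resp (𝕊.⁻¹-cong {f} {g} f≈g x) (reflects F x∈S)
        }
    ; ε-closed  = toAutFixing {𝕊.ε} record
        { homo = λ _ _ → refl ; preserves = id ; reflects = id }
    ; ∙-closed  = λ {f} {g} Kf Kg →
        let F = fromAutFixing {f} Kf ; F′ = fromAutFixing {g} Kg in toAutFixing {f 𝕊.∙ g} record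
        { homo      = λ x y → trans (to-cong g (homo F x y)) (homo F′ (to f x) (to f y))
        ; preserves = preserves F′ ∘ preserves F
        ; reflects  = reflects F ∘ reflects F′
        }
    ; ⁻¹-closed = λ {f} Kf → let F = fromAutFixing {f} Kf in toAutFixing {f 𝕊.⁻¹} record
        { homo = from-homo F ; preserves = reflects F ; reflects = preserves F }
    }

  AutFixing⊆Aut : ∀ {f} → K f → A f
  AutFixing⊆Aut {f} Kf x y = mk⇔
    (λ (s , s∈S , y≈sx) → to f s , preserves F s∈S , trans (to-cong f y≈sx) (homo F s x))
    (λ (s , s∈S , fy≈sfx) → from f s , reflects F s∈S , to-injective f (begin
      to f y                      ≈⟨ fy≈sfx ⟩
      s ∙ to f x                  ≈⟨ ∙-congʳ (strictlyInverseˡ f s) ⟨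
      to f (from f s) ∙ to f x    ≈⟨ homo F (from f s) x ⟨
      to f (from f s ∙ x)         ∎))
    where F = fromAutFixing {f} Kf

  RightRegular∩AutFixing : ∀ {f} → R f → K f → f 𝕊.≈ 𝕊.ε
  RightRegular∩AutFixing {f} (a , fa) Kf x = begin
    to f x   ≈⟨ fa x ⟩
    x ∙ a    ≈⟨ ∙-congˡ a≈ε ⟩
    x ∙ ε    ≈⟨ identityʳ x ⟩
    x        ∎
    where
    a≈ε : a ≈ ε
    a≈ε = trans (sym (identityˡ a)) (trans (sym (fa ε)) (ε-homo (fromAutFixing {f} Kf)))

  -- The label of the image under f of the edge with label t at h.

  label : Perm → Carrier → Carrier → Carrier
  label f h t = to f (t ∙ h) // to f h

  module _ (f : Perm) where
    label-∙ : ∀ h t → label f h t ∙ to f h ≈ to f (t ∙ h)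
    label-∙ h t = //-rightDividesˡ (to f h) (to f (t ∙ h))

    label-unique : ∀ {h t s} → s ∙ to f h ≈ to f (t ∙ h) → label f h t ≈ s
    label-unique {h} {t} {s} eq = sym (x≈z//y s (to f h) (to f (t ∙ h)) eq)

    label-cong : ∀ {h h′ t t′} → h ≈ h′ → t ≈ t′ → label f h t ≈ label f h′ t′
    label-cong h≈ t≈ = ∙-cong (to-cong f (∙-cong t≈ h≈)) (⁻¹-cong (to-cong f h≈))

    label-injective : ∀ h {s t} → label f h s ≈ label f h t → s ≈ t
    label-injective h {s} {t} eq = ∙-cancelʳ h s t
      (to-injective f (∙-cancelʳ (to f h ⁻¹) (to f (s ∙ h)) (to f (t ∙ h)) eq))

    -- The inverse of `f` undoes the relabelling, so what is proved about the labels of every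
    -- automorphism can also be read backwards.
    label-inverse : ∀ h t → label (f 𝕊.⁻¹) (to f h) (label f h t) ≈ t
    label-inverse h t = label-unique′ (begin
      t ∙ from f (to f h)              ≈⟨ ∙-congˡ (strictlyInverseʳ f h) ⟩
      t ∙ h                            ≈⟨ strictlyInverseʳ f (t ∙ h) ⟨
      from f (to f (t ∙ h))            ≈⟨ from-cong f (label-∙ h t) ⟨
      from f (label f h t ∙ to f h)    ∎)
      where
      -- This is `label-unique` for `f 𝕊.⁻¹`; the enclosing module keeps `f` fixed, so it is derived
      -- anew.
      label-unique′ : ∀ {h t s} → s ∙ from f h ≈ from f (t ∙ h) → label (f 𝕊.⁻¹) h t ≈ s
      label-unique′ {h} {t} {s} eq = sym (x≈z//y s (from f h) (from f (t ∙ h)) eq)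

    label∈S : A f → ∀ h {t} → member t → member (label f h t)
    label∈S Af h {t} t∈S =
      let (s , s∈S , eq) = Equivalence.to (Af h (t ∙ h)) (t , t∈S , refl)
      in resp (sym (label-unique (sym eq))) s∈S

  -- Locally constant labels yield the semidirect product.

  LabelsLocallyConstant : Set _
  LabelsLocallyConstant =
    ∀ f → A f → ∀ {s t} → member s → member t → ∀ h → label f (s ∙ h) t ≈ label f h t

  module _ (generates : Generates G member) (locallyConstant : LabelsLocallyConstant) where

    module Decomposition (f : Perm) (Af : A f) where
      private e′ = to f ε

      labels-constant : ∀ {x t} → member t → ∀ h → label f (x ∙ h) t ≈ label f h t
      labels-constant {x} {t} t∈S = go (generates x)
        where
        go : ∀ {x} → ⟨_⟩ G member x → ∀ h → label f (x ∙ h) t ≈ label f h t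
        go (gen x∈S)    h = locallyConstant f Af x∈S t∈S h
        go unit         h = label-cong f (identityˡ h) refl
        go (mul {x} {y} p q)    h = trans (label-cong f (assoc x y h) refl) (trans (go p (y ∙ h)) (go q h))
        -- The induction hypothesis is used backwards, at the vertex `x ⁻¹ ∙ h`; this is why `go`
        -- quantifies over `h`.
        go (inv {x} p)      h = trans (sym (go p (x ⁻¹ ∙ h))) (label-cong f (\\-leftDividesˡ x h) refl)
        go (resp-≈ x≈y p) h = trans (label-cong f (∙-congʳ (sym x≈y)) refl) (go p h)

      -- For a generator `x` this is the equality of its labels at `h` and at `ε`, the latter being
      -- `to f x // e′`. The elements that satisfy it for all `h` are closed under products and
      -- inverses, so generation suffices. Both the homomorphism law and normality are read off from
      -- it.
      affine : ∀ x h → to f (x ∙ h) ≈ (to f x // e′) ∙ to f h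
      affine x = go (generates x)
        where
        go : ∀ {x} → ⟨_⟩ G member x → ∀ h → to f (x ∙ h) ≈ (to f x // e′) ∙ to f h
        go (gen {x} x∈S) h = begin
          to f (x ∙ h)                ≈⟨ label-∙ f h x ⟨
          label f h x ∙ to f h        ≈⟨ ∙-congʳ (label-cong f (identityʳ h) refl) ⟨
          label f (h ∙ ε) x ∙ to f h  ≈⟨ ∙-congʳ (labels-constant x∈S ε) ⟩
          label f ε x ∙ to f h        ≈⟨ ∙-congʳ (∙-congʳ (to-cong f (identityʳ x))) ⟩
          (to f x // e′) ∙ to f h     ∎
        go unit h = begin
          to f (ε ∙ h)         ≈⟨ to-cong f (identityˡ h) ⟩
          to f h               ≈⟨ identityˡ (to f h) ⟨
          ε ∙ to f h           ≈⟨ ∙-congʳ (inverseʳ e′) ⟨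
          (e′ // e′) ∙ to f h  ∎
        go (mul {x} {y} p q) h = begin
          to f (x ∙ y ∙ h)                              ≈⟨ to-cong f (assoc x y h) ⟩
          to f (x ∙ (y ∙ h))                            ≈⟨ go p (y ∙ h) ⟩
          (to f x // e′) ∙ to f (y ∙ h)                 ≈⟨ ∙-congˡ (go q h) ⟩
          (to f x // e′) ∙ ((to f y // e′) ∙ to f h)    ≈⟨ assoc _ _ _ ⟨
          (to f x // e′) ∙ (to f y // e′) ∙ to f h      ≈⟨ ∙-congʳ (assoc _ _ _) ⟨
          (((to f x // e′) ∙ to f y) // e′) ∙ to f h    ≈⟨ ∙-congʳ (∙-congʳ (go p y)) ⟨
          (to f (x ∙ y) // e′) ∙ to f h                 ∎
        go (inv {x} p) h = begin
          to f (x ⁻¹ ∙ h)                   ≈⟨ shift h ⟩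
          g ⁻¹ ∙ to f h                     ≈⟨ ∙-congʳ (//-rightDividesʳ e′ (g ⁻¹)) ⟨
          (g ⁻¹ ∙ e′ // e′) ∙ to f h        ≈⟨ ∙-congʳ (∙-congʳ (trans (to-cong f (sym (identityʳ (x ⁻¹)))) (shift ε))) ⟨
          (to f (x ⁻¹) // e′) ∙ to f h      ∎
          where
          g = to f x // e′
          shift : ∀ h → to f (x ⁻¹ ∙ h) ≈ g ⁻¹ ∙ to f h
          shift h = y≈x\\z g _ _ (trans (sym (go p (x ⁻¹ ∙ h))) (to-cong f (\\-leftDividesˡ x h)))
        go (resp-≈ {x} {y} x≈y p) h = begin
          to f (y ∙ h)              ≈⟨ to-cong f (∙-congʳ x≈y) ⟨
          to f (x ∙ h)              ≈⟨ go p h ⟩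
          (to f x // e′) ∙ to f h   ≈⟨ ∙-congʳ (∙-congʳ (to-cong f x≈y)) ⟩
          (to f y // e′) ∙ to f h   ∎

      normalised : Perm
      normalised = f 𝕊.∙ rightTranslation (e′ ⁻¹)

      -- Multiplying `affine` by `e′ ⁻¹` on the right gives the homomorphism law. On generators,
      -- `normalised` takes the labels of `f` at `ε` as values, and its inverse the labels of
      -- `f 𝕊.⁻¹` at `e′`; both lie in `member` because `f` and its inverse are graph automorphisms.
      normalised-fixes : IsFixingAut normalised
      normalised-fixes = record
        { homo = λ x y → trans (∙-congʳ (affine x y)) (assoc _ _ _)
        ; preserves = λ {x} x∈S → resp (∙-congʳ (to-cong f (identityʳ x))) (label∈S f Af ε x∈S)
        ; reflects = λ {x} x∈S →
            resp (lemma x) (label∈S (f 𝕊.⁻¹) (Aut-⁻¹ {f} Af) e′ x∈S)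
        }
        where
        lemma : ∀ x → label (f 𝕊.⁻¹) e′ x ≈ from normalised x
        lemma x = begin
          from f (x ∙ e′) // from f e′   ≈⟨ ∙-congˡ (⁻¹-cong (strictlyInverseʳ f ε)) ⟩
          from f (x ∙ e′) // ε           ≈⟨ trans (∙-congˡ ε⁻¹≈ε) (identityʳ _) ⟩
          from f (x ∙ e′)                ≈⟨ from-cong f (∙-congˡ (⁻¹-involutive e′)) ⟨
          from f (x ∙ e′ ⁻¹ ⁻¹)          ∎

      -- Products in `Sym` apply the left factor first. Right multiplication by `e′` after
      -- `normalised` must therefore be moved in front of it, which replaces `e′` by its preimage.
      translation : Perm
      translation = rightTranslation (from normalised e′)

      factorises : f 𝕊.≈ translation 𝕊.∙ normalised
      factorises x = begin
        to f x                                             ≈⟨ //-rightDividesˡ e′ (to f x) ⟨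
        to normalised x ∙ e′                               ≈⟨ ∙-congˡ (strictlyInverseˡ normalised e′) ⟨
        to normalised x ∙ to normalised (from normalised e′) ≈⟨ homo normalised-fixes x (from normalised e′) ⟨
        to normalised (x ∙ from normalised e′)             ∎

      conjugate : ∀ {g} → R g → R (f 𝕊.⁻¹ 𝕊.∙ g 𝕊.∙ f)
      conjugate {g} (a , ga) = e′ ⁻¹ ∙ to f a , λ x → begin
        to f (to g (from f x))               ≈⟨ to-cong f (ga (from f x)) ⟩
        to f (from f x ∙ a)                  ≈⟨ affine (from f x) a ⟩
        (to f (from f x) // e′) ∙ to f a     ≈⟨ ∙-congʳ (∙-congʳ (strictlyInverseˡ f x)) ⟩
        (x // e′) ∙ to f a                   ≈⟨ assoc _ _ _ ⟩
        x ∙ (e′ ⁻¹ ∙ to f a)                 ∎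

    isInternalSemidirectProduct : IsInternalSemidirectProduct (Sym setoid) A R K
    isInternalSemidirectProduct = record
      { isSubgroup   = Aut-isSubgroup
      ; normal       = record
        { isSubgroup       = RightRegular-isSubgroup
        ; contained        = λ {f} → RightRegular⊆Aut {f}
        ; conjugate-closed = λ {f} {g} Af → Decomposition.conjugate f Af {g}
        }
      ; complement    = AutFixing-isSubgroup
      ; complement-⊆  = λ {f} → AutFixing⊆Aut {f}
      ; trivial-∩     = λ {f} → RightRegular∩AutFixing {f}
      ; factorisation =
          (λ {f} Af → let open Decomposition f Af in
            translation , normalised , (from normalised (to f ε) , λ _ → refl) ,
            toAutFixing {normalised} normalised-fixes , factorises)
        , (λ {f} (g , k , Rg , Kk , f≈gk) → Aut-resp {g 𝕊.∙ k} {f} (λ x → sym (f≈gk x))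
            (IsSubgroup.∙-closed Aut-isSubgroup {g} {k} (RightRegular⊆Aut {g} Rg) (AutFixing⊆Aut {k} Kk)))
      }

  -- Local constancy of labels from relations between generators.

  Commute : Carrier → Carrier → Set ℓ
  Commute s t = s ∙ t ≈ t ∙ s

  Commute-resp : ∀ {s s′ t t′} → s ≈ s′ → t ≈ t′ → Commute s t → Commute s′ t′
  Commute-resp s≈ t≈ st≈ts = trans (sym (∙-cong s≈ t≈)) (trans st≈ts (∙-cong t≈ s≈))

  -- These hypotheses are what the label argument asks of the connection set. `square` says that the
  -- two sides of a 4-cycle interchange their labels; `hexagon` says that in a closed walk of length
  -- six without commuting consecutive labels, the two neighbours of `a₁` agree.
  module _
    (_≈?_ : Decidable _≈_)
    (involutive : ∀ {s} → member s → s ∙ s ≈ ε)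
    (square : ∀ {s t c d} → member s → member t → member c → member d →
      ¬ s ≈ t → ¬ c ≈ s → c ∙ s ≈ d ∙ t → c ≈ t × d ≈ s)
    (braid : ∀ {s t} → member s → member t → ¬ Commute s t → s ∙ (t ∙ s) ≈ t ∙ (s ∙ t))
    (hexagon : ∀ {a₁ a₂ a₃ a₄ a₅ a₆} →
      member a₁ → member a₂ → member a₃ → member a₄ → member a₅ → member a₆ →
      ¬ Commute a₁ a₂ → ¬ Commute a₂ a₃ → ¬ Commute a₃ a₄ →
      ¬ Commute a₄ a₅ → ¬ Commute a₅ a₆ → ¬ Commute a₆ a₁ →
      a₃ ∙ (a₂ ∙ a₁) ≈ a₄ ∙ (a₅ ∙ a₆) → a₂ ≈ a₆)
    where

    private
      module _ (f : Perm) (Af : A f) where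
        ∈S : ∀ h {t} → member t → member (label f h t)
        ∈S = label∈S f Af

        label-path : ∀ h s t → label f (s ∙ h) t ∙ label f h s ∙ to f h ≈ to f (t ∙ (s ∙ h))
        label-path h s t = begin
          label f (s ∙ h) t ∙ label f h s ∙ to f h    ≈⟨ assoc _ _ _ ⟩
          label f (s ∙ h) t ∙ (label f h s ∙ to f h)  ≈⟨ ∙-congˡ (label-∙ f h s) ⟩
          label f (s ∙ h) t ∙ to f (s ∙ h)            ≈⟨ label-∙ f (s ∙ h) t ⟩
          to f (t ∙ (s ∙ h))                          ∎

        label-back : ∀ {s} → member s → ∀ h → label f (s ∙ h) s ≈ label f h s
        label-back {s} s∈S h = label-unique f (begin
          label f h s ∙ to f (s ∙ h)              ≈⟨ ∙-congˡ (label-∙ f h s) ⟨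
          label f h s ∙ (label f h s ∙ to f h)    ≈⟨ assoc _ _ _ ⟨
          label f h s ∙ label f h s ∙ to f h      ≈⟨ ∙-congʳ (involutive (∈S h s∈S)) ⟩
          ε ∙ to f h                              ≈⟨ identityˡ _ ⟩
          to f h                                  ≈⟨ to-cong f (identityˡ h) ⟨
          to f (ε ∙ h)                            ≈⟨ to-cong f (∙-congʳ (involutive s∈S)) ⟨
          to f (s ∙ s ∙ h)                        ≈⟨ to-cong f (assoc s s h) ⟩
          to f (s ∙ (s ∙ h))                      ∎)

        -- `f` maps the 4-cycle of `st = ts` at `h` to a closed walk to which `square` applies. The
        -- second component is kept so that it can be applied to the inverse of `f` in
        -- `noncommuting-labels`.
        commuting-labels : ∀ {s t} → member s → member t → ¬ s ≈ t → Commute s t → ∀ h →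
          label f (s ∙ h) t ≈ label f h t × Commute (label f h s) (label f h t)
        commuting-labels {s} {t} s∈S t∈S s≉t st≈ts h =
          let (c≈ , d≈) = square (∈S h s∈S) (∈S h t∈S) (∈S (s ∙ h) t∈S) (∈S (t ∙ h) s∈S)
                (s≉t ∘ label-injective f h) c≉ closed
          in c≈ , trans (∙-congʳ (sym d≈)) (trans (sym closed) (∙-congʳ c≈))
          where
          -- Otherwise the image walk would return along its first edge: by `label-back`,
          -- `label f h s` is also the label of `s` at `s ∙ h`.
          c≉ : ¬ label f (s ∙ h) t ≈ label f h s
          c≉ eq = s≉t (sym (label-injective f (s ∙ h) (trans eq (sym (label-back s∈S h)))))

          closed : label f (s ∙ h) t ∙ label f h s ≈ label f (t ∙ h) s ∙ label f h t
          closed = ∙-cancelʳ (to f h) _ _ (begin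
            label f (s ∙ h) t ∙ label f h s ∙ to f h   ≈⟨ label-path h s t ⟩
            to f (t ∙ (s ∙ h))                         ≈⟨ to-cong f (assoc t s h) ⟨
            to f (t ∙ s ∙ h)                           ≈⟨ to-cong f (∙-congʳ st≈ts) ⟨
            to f (s ∙ t ∙ h)                           ≈⟨ to-cong f (assoc s t h) ⟩
            to f (s ∙ (t ∙ h))                         ≈⟨ label-path h t s ⟨
            label f (t ∙ h) s ∙ label f h t ∙ to f h   ∎)

      -- If the labels commuted, `commuting-labels` for the inverse automorphism would make `s` and
      -- `t` commute. It requires distinct labels, and equal labels would mean `s ≈ t`, which
      -- commutes trivially.
      noncommuting-labels : ∀ f → A f → ∀ {s t} → member s → member t → ¬ Commute s t → ∀ h →
        ¬ Commute (label f h s) (label f h t)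
      noncommuting-labels f Af {s} {t} s∈S t∈S st≉ts h comm = st≉ts
        (Commute-resp (label-inverse f h s) (label-inverse f h t)
          (proj₂ (commuting-labels (f 𝕊.⁻¹) (Aut-⁻¹ {f} Af) (∈S f Af h s∈S) (∈S f Af h t∈S)
            (λ eq → st≉ts (let s≈t = label-injective f h eq in
              trans (∙-congˡ (sym s≈t)) (∙-congʳ s≈t))) comm (to f h))))

      braid-labels : ∀ f → A f → ∀ {s t} → member s → member t → ¬ Commute s t → ∀ h →
        label f (s ∙ h) t ≈ label f h t
      braid-labels f Af {s} {t} s∈S t∈S st≉ts h =
        -- The letters `a₁`, `a₂`, `a₃` label the image of the path `s`, `t`, `s` from `h`, and
        -- `a₆`, `a₅`, `a₄` that of `t`, `s`, `t`. The conclusion `a₂ ≈ a₆` is then the claim.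
        hexagon (∈S f Af h s∈S) (∈S f Af (s ∙ h) t∈S) (∈S f Af (t ∙ (s ∙ h)) s∈S)
          (∈S f Af (s ∙ (t ∙ h)) t∈S) (∈S f Af (t ∙ h) s∈S) (∈S f Af h t∈S)
          -- At each vertex of the hexagon the two incident edges carry the images of `s` and `t`
          -- there; `back` rebases an edge at its other end. The vertex where the two paths meet has
          -- two names, identified by `sts≈tst`.
          (nc (s ∙ h) (back s∈S h) refl)
          (nc (t ∙ (s ∙ h)) refl (back t∈S (s ∙ h)) ∘ sym)
          (nc (s ∙ (t ∙ (s ∙ h))) (back s∈S (t ∙ (s ∙ h)))
            (trans (label-cong f sts≈tst refl) (back t∈S (s ∙ (t ∙ h)))))
          (nc (s ∙ (t ∙ h)) (back s∈S (t ∙ h)) refl ∘ sym)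
          (nc (t ∙ h) refl (back t∈S h))
          (nc h refl refl ∘ sym)
          (∙-cancelʳ (to f h) _ _ (trans (longPath s t) (trans (to-cong f sts≈tst) (sym (longPath t s)))))
        where
        back = label-back f Af

        nc : ∀ h {a b} → label f h s ≈ a → label f h t ≈ b → ¬ Commute a b
        nc h s≈ t≈ comm = noncommuting-labels f Af s∈S t∈S st≉ts h (Commute-resp (sym s≈) (sym t≈) comm)

        sts≈tst : s ∙ (t ∙ (s ∙ h)) ≈ t ∙ (s ∙ (t ∙ h))
        sts≈tst = begin
          s ∙ (t ∙ (s ∙ h))   ≈⟨ ∙-congˡ (assoc t s h) ⟨
          s ∙ (t ∙ s ∙ h)     ≈⟨ assoc s (t ∙ s) h ⟨
          s ∙ (t ∙ s) ∙ h     ≈⟨ ∙-congʳ (braid s∈S t∈S st≉ts) ⟩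
          t ∙ (s ∙ t) ∙ h     ≈⟨ assoc t (s ∙ t) h ⟩
          t ∙ (s ∙ t ∙ h)     ≈⟨ ∙-congˡ (assoc s t h) ⟩
          t ∙ (s ∙ (t ∙ h))   ∎

        longPath : ∀ s t → label f (t ∙ (s ∙ h)) s ∙ (label f (s ∙ h) t ∙ label f h s) ∙ to f h
          ≈ to f (s ∙ (t ∙ (s ∙ h)))
        longPath s t = begin
          label f (t ∙ (s ∙ h)) s ∙ (label f (s ∙ h) t ∙ label f h s) ∙ to f h   ≈⟨ assoc _ _ _ ⟩
          label f (t ∙ (s ∙ h)) s ∙ (label f (s ∙ h) t ∙ label f h s ∙ to f h)   ≈⟨ ∙-congˡ (label-path f Af h s t) ⟩
          label f (t ∙ (s ∙ h)) s ∙ to f (t ∙ (s ∙ h))                           ≈⟨ label-∙ f (t ∙ (s ∙ h)) s ⟩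
          to f (s ∙ (t ∙ (s ∙ h)))                                               ∎

    labelsLocallyConstant : LabelsLocallyConstant
    labelsLocallyConstant f Af {s} {t} s∈S t∈S h with s ≈? t | (s ∙ t) ≈? (t ∙ s)
    ... | yes s≈t | _ = begin
      label f (s ∙ h) t   ≈⟨ label-cong f refl s≈t ⟨
      label f (s ∙ h) s   ≈⟨ label-back f Af s∈S h ⟩
      label f h s         ≈⟨ label-cong f refl s≈t ⟩
      label f h t         ∎
    ... | no s≉t | yes st≈ts = proj₁ (commuting-labels f Af s∈S t∈S s≉t st≈ts h)
    ... | no _   | no st≉ts  = braid-labels f Af s∈S t∈S st≉ts h

-- Transpositions as edges of a graph of girth at least five.

module TranspositionProducts {n p} (S : TranspositionSet n p)
  (girth≥5 : ∀ {k} → Cycle (transpositionGraph S) k → 5 ≤ k) where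
  open TranspositionSet S
  open Group (Sₙ n) using (_≈_; _∙_)
  open SimpleGraph (transpositionGraph S) using (Adj)

  open ≡ using (refl; sym; trans; cong; subst)

  private
    variable
      a b c d e s t a₁ a₂ a₃ a₄ a₅ a₆ : Permutation′ n
      u v w x y z : Fin n

  infixr 8 _·_
  -- Since `a ∙ b` applies `a` first, it sends `u` to `b · a · u`: words in `_∙_` are reversed when
  -- written with `_·_`.
  _·_ : Permutation′ n → Fin n → Fin n
  _·_ = Inverse.to

  ·-injective : ∀ a → a · u ≡ a · v → u ≡ v
  ·-injective a eq =
    trans (sym (Inverse.strictlyInverseʳ a _)) (trans (cong (Inverse.from a) eq) (Inverse.strictlyInverseʳ a _))

  _≈?_ : Decidable _≈_
  a ≈? b = all? (λ u → a · u ≟ b · u)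

  no-triangle : Adj u v → Adj v w → ¬ Adj w u
  no-triangle {u} {v} {w} uv vw wu = case-5≤3 (girth≥5 (cycle (s≤s (s≤s (s≤s z≤n)))
    (lookup (u ∷ v ∷ w ∷ []))
    (lookup-injective ((proj₁ uv ∷ ≢-sym (proj₁ wu) ∷ []) ∷ (proj₁ vw ∷ []) ∷ [] ∷ []) _ _)
    (λ { zero → uv ; (suc zero) → vw }) wu))
    where
    case-5≤3 : ¬ 5 ≤ 3
    case-5≤3 (s≤s (s≤s (s≤s ())))

  no-square : Adj u v → Adj v w → Adj w x → u ≢ w → v ≢ x → ¬ Adj x u
  no-square {u} {v} {w} {x} uv vw wx u≢w v≢x xu = case-5≤4 (girth≥5 (cycle (s≤s (s≤s (s≤s z≤n)))
    (lookup (u ∷ v ∷ w ∷ x ∷ []))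
    (lookup-injective
      ((proj₁ uv ∷ u≢w ∷ ≢-sym (proj₁ xu) ∷ []) ∷ (proj₁ vw ∷ v≢x ∷ []) ∷ (proj₁ wx ∷ []) ∷ [] ∷ []) _ _)
    (λ { zero → uv ; (suc zero) → vw ; (suc (suc zero)) → wx }) xu))
    where
    case-5≤4 : ¬ 5 ≤ 4
    case-5≤4 (s≤s (s≤s (s≤s (s≤s ()))))

  -- A record, so that a can be inferred: the function underlying a
  -- permutation does not determine it definitionally.

  record _∶_↦_ (a : Permutation′ n) (u v : Fin n) : Set where
    constructor maps
    field image : a · u ≡ v

  open _∶_↦_

  chain₂ : a ∶ u ↦ v → b ∶ v ↦ w → b · a · u ≡ w
  chain₂ {b = b} (maps au) (maps bv) = trans (cong (b ·_) au) bv

  chain₃ : a ∶ u ↦ v → b ∶ v ↦ w → c ∶ w ↦ x → c · b · a · u ≡ x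
  chain₃ {c = c} au bv (maps cw) = trans (cong (c ·_) (chain₂ au bv)) cw

  -- An element of the set seen as an oriented edge of the transposition graph. That all other
  -- points are fixed is recovered in `fixes` from `∈S`.
  record Joins (a : Permutation′ n) (u v : Fin n) : Set p where
    field
      ∈S       : member a
      forth    : a ∶ u ↦ v
      back     : a ∶ v ↦ u
      distinct : u ≢ v

  open Joins

  flip : Joins a u v → Joins a v u
  flip j = record { ∈S = ∈S j ; forth = back j ; back = forth j ; distinct = ≢-sym (distinct j) }

  private
    endpoints : (a∈S : member a) → let (i , j , _) = transpositions a∈S in
      a · u ≢ u → (u ≡ i × a · u ≡ j) ⊎ (u ≡ j × a · u ≡ i)
    endpoints {a} {u} a∈S au≢u with transpositions a∈S
    ... | i , j , _ , a≈ij with u ≟ i | u ≟ j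
    ... | yes refl | _        = inj₁ (refl , trans (a≈ij u) (transpose-matchˡ i j))
    ... | no _     | yes refl = inj₂ (refl , trans (a≈ij u) (transpose-matchʳ i j))
    ... | no u≢i   | no u≢j   = contradiction (trans (a≈ij u) (transpose-mismatch i j u≢i u≢j)) au≢u

  some-edge : member a → ∃₂ (Joins a)
  some-edge a∈S with transpositions a∈S
  ... | i , j , i≢j , a≈ij = i , j , record
    { ∈S       = a∈S
    ; forth    = maps (trans (a≈ij i) (transpose-matchˡ i j))
    ; back     = maps (trans (a≈ij j) (transpose-matchʳ i j))
    ; distinct = i≢j
    }

  -- If `w` were moved, then `w` and `u` would both be among the two points supplied by
  -- `transpositions`, so that `w` would be `u` or its image `v`.
  fixes : Joins a u v → w ≢ u → w ≢ v → a ∶ w ↦ w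
  fixes {a} {u} {v} {w} j w≢u w≢v = maps (decidable-stable (a · w ≟ w) (λ aw≢w →
    go (endpoints (∈S j) aw≢w) (endpoints (∈S j) (distinct j ∘ λ au≡u → trans (sym au≡u) (image (forth j))))))
    where
    go : ∀ {i k} → (w ≡ i × a · w ≡ k) ⊎ (w ≡ k × a · w ≡ i) →
      (u ≡ i × a · u ≡ k) ⊎ (u ≡ k × a · u ≡ i) → ⊥
    go (inj₁ (w≡i , _)) (inj₁ (u≡i , _)) = w≢u (trans w≡i (sym u≡i))
    go (inj₂ (w≡k , _)) (inj₂ (u≡k , _)) = w≢u (trans w≡k (sym u≡k))
    go (inj₁ (w≡i , _)) (inj₂ (_ , au≡i)) = w≢v (trans w≡i (trans (sym au≡i) (image (forth j))))
    go (inj₂ (w≡k , _)) (inj₁ (_ , au≡k)) = w≢v (trans w≡k (trans (sym au≡k) (image (forth j))))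

  only : Joins a u v → a · w ≢ w → w ≡ u ⊎ w ≡ v
  only {u = u} {v} {w} j aw≢w with w ≟ u | w ≟ v
  ... | yes w≡u | _       = inj₁ w≡u
  ... | no _    | yes w≡v = inj₂ w≡v
  ... | no w≢u  | no w≢v  = contradiction (image (fixes j w≢u w≢v)) aw≢w

  involution : member a → ∀ u → a · a · u ≡ u
  involution {a} a∈S w with some-edge a∈S
  ... | u , v , j with w ≟ u | w ≟ v
  ... | yes refl | _        = chain₂ (forth j) (back j)
  ... | no _     | yes refl = chain₂ (back j) (forth j)
  ... | no w≢u   | no w≢v   = let f = fixes j w≢u w≢v in chain₂ f f

  joins : member a → a ∶ u ↦ v → u ≢ v → Joins a u v
  joins {a} {u} a∈S f@(maps au≡v) u≢v = record
    { ∈S = a∈S ; forth = f ; back = maps (trans (cong (a ·_) (sym au≡v)) (involution a∈S u)) ; distinct = u≢v }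

  moved : member a → a · u ≢ u → Joins a u (a · u)
  moved a∈S au≢u = joins a∈S (maps refl) (≢-sym au≢u)

  moves : Joins a u v → a · u ≢ u
  moves j au≡u = distinct j (trans (sym au≡u) (image (forth j)))

  determined : Joins a u v → b · u ≡ v → b · v ≡ u → (∀ {w} → w ≢ u → w ≢ v → b · w ≡ w) → a ≈ b
  determined {u = u} {v} j bu≡v bv≡u b-fixes w with w ≟ u | w ≟ v
  ... | yes refl | _        = trans (image (forth j)) (sym bu≡v)
  ... | no _     | yes refl = trans (image (back j)) (sym bv≡u)
  ... | no w≢u   | no w≢v   = trans (image (fixes j w≢u w≢v)) (sym (b-fixes w≢u w≢v))

  parallel : Joins a u v → Joins b u v → a ≈ b
  parallel {b = b} j k = determined {b = b} j (image (forth k)) (image (back k)) (λ w≢u w≢v → image (fixes k w≢u w≢v))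

  Joins⇒Adj : Joins a u v → Adj u v
  Joins⇒Adj {a} {u} {v} j = distinct j , resp {a} {transpose u v}
    (determined {b = transpose u v} j (transpose-matchˡ u v) (transpose-matchʳ u v) (transpose-mismatch u v)) (∈S j)

  triangle-free : Joins a u v → Joins b v w → ¬ Joins c w u
  triangle-free i j k = no-triangle (Joins⇒Adj i) (Joins⇒Adj j) (Joins⇒Adj k)

  square-free : Joins a u v → Joins b v w → Joins c w x → u ≢ w → v ≢ x → ¬ Joins d x u
  square-free i j k u≢w v≢x l = no-square (Joins⇒Adj i) (Joins⇒Adj j) (Joins⇒Adj k) u≢w v≢x (Joins⇒Adj l)

  -- Non-commuting transpositions, the braid relation and 4-cycles.

  -- The graph form of non-commutation: two different edges that meet in `center`.
  record Linked (a b : Permutation′ n) : Set p where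
    constructor linked
    field
      {center left right} : Fin n
      joinsˡ    : Joins a center left
      joinsʳ    : Joins b center right
      left≢right : left ≢ right

  Linked-sym : Linked a b → Linked b a
  Linked-sym (linked j k p≢q) = linked k j (≢-sym p≢q)

  Linked⇒≉ : Linked a b → ¬ a ≈ b
  Linked⇒≉ (linked {z} j k p≢q) a≈b = p≢q (trans (sym (image (forth j))) (trans (a≈b z) (image (forth k))))

  -- A point moved by both serves as the center; equal far ends would make the transpositions equal.
  -- Without such a point the supports are disjoint, and the transpositions commute.
  noncommuting⇒Linked : member a → member b → ¬ a ∙ b ≈ b ∙ a → Linked a b
  noncommuting⇒Linked {a} {b} a∈S b∈S ab≉ba
    with any? (λ z → ¬? (a · z ≟ z) ×-dec ¬? (b · z ≟ z))
  ... | yes (z , az≢z , bz≢z) = linked (moved a∈S az≢z) (moved b∈S bz≢z)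
    (λ az≡bz → ab≉ba (λ u → let a≈b = parallel (subst (Joins a z) az≡bz (moved a∈S az≢z)) (moved b∈S bz≢z) in
      trans (cong (b ·_) (a≈b u)) (sym (a≈b (b · u)))))
  ... | no disjoint = contradiction commute ab≉ba
    where
    commute : a ∙ b ≈ b ∙ a
    commute u with a · u ≟ u | b · u ≟ u
    ... | yes au≡u | yes bu≡u = trans (chain₂ {a} {b = b} (maps au≡u) (maps bu≡u))
      (sym (chain₂ {b} {b = a} (maps bu≡u) (maps au≡u)))
    ... | no au≢u  | no bu≢u  = contradiction (u , au≢u , bu≢u) disjoint
    -- As `b` moves `b · u` as well, disjointness makes `a` fix it.
    ... | yes au≡u | no bu≢u  = trans (cong (b ·_) au≡u) (sym (decidable-stable (a · b · u ≟ b · u)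
      (λ a≢ → disjoint (b · u , a≢ , moves (flip (moved b∈S bu≢u))))))
    ... | no au≢u  | yes bu≡u = trans (decidable-stable (b · a · u ≟ a · u)
      (λ b≢ → disjoint (a · u , moves (flip (moved a∈S au≢u)) , b≢))) (sym (cong (a ·_) bu≡u))

  -- Both sides are the transposition of the two outer ends `q` and `r`.
  braid : Linked s t → s ∙ (t ∙ s) ≈ t ∙ (s ∙ t)
  braid {s} {t} (linked {z} {q} {r} j k q≢r) u = go (u ≟ z) (u ≟ q) (u ≟ r)
    where
    tq = fixes k (≢-sym (distinct j)) q≢r
    sr = fixes j (≢-sym (distinct k)) (≢-sym q≢r)

    go : Dec (u ≡ z) → Dec (u ≡ q) → Dec (u ≡ r) → s · t · s · u ≡ t · s · t · u
    go (yes refl) _ _ = trans (chain₃ (forth j) tq (back j)) (sym (chain₃ (forth k) sr (back k)))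
    go _ (yes refl) _ = trans (chain₃ (back j) (forth k) sr) (sym (chain₃ tq (back j) (forth k)))
    go _ _ (yes refl) = trans (chain₃ sr (back k) (forth j)) (sym (chain₃ (back k) (forth j) tq))
    go (no u≢z) (no u≢q) (no u≢r) = trans (chain₃ su tu su) (sym (chain₃ tu su tu))
      where
      su = fixes j u≢z u≢q
      tu = fixes k u≢z u≢r

  private
    -- If `t` moved both ends of `s`, the two would be parallel edges and hence equal.
    fixed-opposite : ∀ s t → member s → member t → ¬ s ≈ t → ∃₂ λ u v → Joins s u v × t ∶ v ↦ v
    fixed-opposite s t s∈S t∈S s≉t with some-edge s∈S
    ... | u , v , j with t · v ≟ v | t · u ≟ u
    ... | yes tv≡v | _        = u , v , j , maps tv≡v
    ... | no _     | yes tu≡u = v , u , flip j , maps tu≡u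
    ... | no tv≢v  | no tu≢u  with only (moved t∈S tv≢v) tu≢u
    ...   | inj₁ u≡v = contradiction u≡v (distinct j)
    ...   | inj₂ u≡tv = contradiction (parallel j (flip (subst (Joins t v) (sym u≡tv) (moved t∈S tv≢v)))) s≉t

    -- With `q` an end of `s` fixed by `t`, the walk `c`, `d` leads from the other end `z` to `q`.
    -- If `c` fixes `z`, then `d` is the edge `s`; if `c` goes straight to `q`, it is `s`, which is
    -- excluded; otherwise `c`, `d`, `s` form a triangle.
    square-opposite : ∀ s t c d → member s → member t → member c → member d →
      ¬ s ≈ t → ¬ c ≈ s → c ∙ s ≈ d ∙ t → d ≈ s
    square-opposite s t c d s∈S t∈S c∈S d∈S s≉t c≉s cs≈dt with fixed-opposite s t s∈S t∈S s≉t
    ... | z , q , j , tq = go (c · z ≟ z) (c · z ≟ q)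
      where
      dcz≡q : d · c · z ≡ q
      -- Both products are evaluated at `c · z`, and `q` is replaced by `t · q`.
      dcz≡q = ·-injective t (trans (sym (cs≈dt (c · z)))
        (trans (cong (s ·_) (involution c∈S z)) (trans (image (forth j)) (sym (image tq)))))

      go : Dec (c · z ≡ z) → Dec (c · z ≡ q) → d ≈ s
      go (yes cz≡z) _ = parallel (joins d∈S (maps (trans (cong (d ·_) (sym cz≡z)) dcz≡q)) (distinct j)) j
      go (no _) (yes cz≡q) = contradiction (parallel (joins c∈S (maps cz≡q) (distinct j)) j) c≉s
      go (no cz≢z) (no cz≢q) = contradiction (joins d∈S (maps dcz≡q) cz≢q)
        (λ k → triangle-free (moved c∈S cz≢z) k (flip j))

  square : ∀ {s t c d} → member s → member t → member c → member d →
    ¬ s ≈ t → ¬ c ≈ s → c ∙ s ≈ d ∙ t → c ≈ t × d ≈ s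
  square {s} {t} {c} {d} s∈S t∈S c∈S d∈S s≉t c≉s cs≈dt =
      -- With the roles exchanged the lemma requires `¬ d ≈ t`, which follows from `d≈s`.
      square-opposite t s d c t∈S s∈S d∈S c∈S (λ t≈s → s≉t (λ u → sym (t≈s u)))
        (λ d≈t → s≉t (λ u → trans (sym (d≈s u)) (d≈t u))) (λ u → sym (cs≈dt u))
    , d≈s
    where
    d≈s : d ≈ s
    d≈s = square-opposite s t c d s∈S t∈S c∈S d∈S s≉t c≉s cs≈dt

  -- Trees with three edges.

  -- Three consecutively linked transpositions, the first and the last of
  -- which differ, are the edges of a tree on four vertices.

  data Tree (a b c : Permutation′ n) : Set p where
    star : Joins a z u → Joins b z v → Joins c z w → u ≢ v → v ≢ w → u ≢ w → Tree a b c
    path : Joins a u v → Joins b v w → Joins c w x → u ≢ w → v ≢ x → u ≢ x → Tree a b c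

  -- Both centers lie on the edge `b`: if they coincide the tree is a star, otherwise a path. Equal
  -- ends of `a` and `c` would contradict `¬ a ≈ c` in the star and close a triangle in the path.
  tree : Linked a b → Linked b c → ¬ a ≈ c → Tree a b c
  tree {a} {b} {c} (linked {z} {u} {v} az bz u≢v) (linked {z′} {v′} {w} bz′ cz′ v′≢w) a≉c
    with only bz (moves bz′)
  ... | inj₁ refl = star az bz cz′ u≢v
    (λ v≡w → v′≢w (trans (sym (image (forth bz′))) (trans (image (forth bz)) v≡w)))
    (λ { refl → a≉c (parallel az cz′) })
  ... | inj₂ refl = path (flip az) bz cz′ u≢v
    (λ z≡w → v′≢w (trans (sym (image (forth bz′))) (trans (image (back bz)) z≡w)))
    (λ { refl → triangle-free az (flip cz′) (flip bz) })

  Moves : (a b c : Permutation′ n) → Fin n → Set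
  Moves a b c u = a · u ≢ u ⊎ b · u ≢ u ⊎ c · u ≢ u

  data OneOf (x₀ x₁ x₂ x₃ : Fin n) : Fin n → Set where
    0th : OneOf x₀ x₁ x₂ x₃ x₀
    1st : OneOf x₀ x₁ x₂ x₃ x₁
    2nd : OneOf x₀ x₁ x₂ x₃ x₂
    3rd : OneOf x₀ x₁ x₂ x₃ x₃

  star-vertices : Joins a z u → Joins b z v → Joins c z w → Moves a b c x → OneOf z u v w x
  star-vertices j k l (inj₁ m) with only j m
  ... | inj₁ refl = 0th
  ... | inj₂ refl = 1st
  star-vertices j k l (inj₂ (inj₁ m)) with only k m
  ... | inj₁ refl = 0th
  ... | inj₂ refl = 2nd
  star-vertices j k l (inj₂ (inj₂ m)) with only l m
  ... | inj₁ refl = 0th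
  ... | inj₂ refl = 3rd

  path-vertices : Joins a u v → Joins b v w → Joins c w x → Moves a b c y → OneOf u v w x y
  path-vertices j k l (inj₁ m) with only j m
  ... | inj₁ refl = 0th
  ... | inj₂ refl = 1st
  path-vertices j k l (inj₂ (inj₁ m)) with only k m
  ... | inj₁ refl = 1st
  ... | inj₂ refl = 2nd
  path-vertices j k l (inj₂ (inj₂ m)) with only l m
  ... | inj₁ refl = 2nd
  ... | inj₂ refl = 3rd

  -- The product of the three edges is a 4-cycle on the vertices, so its square fixes none of them.
  -- The names such as `0↦3` follow the numbering of `OneOf`.
  tree-square-moves : Tree a b c → Moves a b c y → a · b · c · a · b · c · y ≢ y
  tree-square-moves {a} {b} {c} {y} (star {z} {u} {v} {w} j k l u≢v v≢w u≢w) m =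
    go (star-vertices j k l m)
    where
    W : Fin n → Fin n
    W x = a · b · c · x
    0↦3 : W z ≡ w
    0↦3 = chain₃ (forth l) (fixes k (≢-sym (distinct l)) (≢-sym v≢w)) (fixes j (≢-sym (distinct l)) (≢-sym u≢w))
    3↦2 : W w ≡ v
    3↦2 = chain₃ (back l) (forth k) (fixes j (≢-sym (distinct k)) (≢-sym u≢v))
    2↦1 : W v ≡ u
    2↦1 = chain₃ (fixes l (≢-sym (distinct k)) v≢w) (back k) (forth j)
    1↦0 : W u ≡ z
    1↦0 = chain₃ (fixes l (≢-sym (distinct j)) u≢w) (fixes k (≢-sym (distinct j)) u≢v) (back j)
    go : OneOf z u v w y → W (W y) ≢ y
    go 0th eq = distinct k (trans (sym eq) (trans (cong W 0↦3) 3↦2))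
    go 1st eq = u≢w (trans (sym eq) (trans (cong W 1↦0) 0↦3))
    go 2nd eq = distinct k (trans (sym (trans (cong W 2↦1) 1↦0)) eq)
    go 3rd eq = u≢w (trans (sym (trans (cong W 3↦2) 2↦1)) eq)
  tree-square-moves {a} {b} {c} {y} (path {u} {v} {w} {x} j k l u≢w v≢x u≢x) m =
    go (path-vertices j k l m)
    where
    W : Fin n → Fin n
    W x = a · b · c · x
    0↦1 : W u ≡ v
    0↦1 = chain₃ (fixes l u≢w u≢x) (fixes k (distinct j) u≢w) (forth j)
    1↦2 : W v ≡ w
    1↦2 = chain₃ (fixes l (distinct k) v≢x) (forth k) (fixes j (≢-sym u≢w) (≢-sym (distinct k)))
    2↦3 : W w ≡ x
    2↦3 = chain₃ (forth l) (fixes k (≢-sym v≢x) (≢-sym (distinct l))) (fixes j (≢-sym u≢x) (≢-sym v≢x))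
    3↦0 : W x ≡ u
    3↦0 = chain₃ (back l) (back k) (back j)
    go : OneOf u v w x y → W (W y) ≢ y
    go 0th eq = u≢w (trans (sym eq) (trans (cong W 0↦1) 1↦2))
    go 1st eq = v≢x (trans (sym eq) (trans (cong W 1↦2) 2↦3))
    go 2nd eq = u≢w (trans (sym (trans (cong W 2↦3) 3↦0)) eq)
    go 3rd eq = v≢x (trans (sym (trans (cong W 3↦0) 0↦1)) eq)

  -- Any further edge between two of the four vertices would close a triangle or, between the ends
  -- of a path, a 4-cycle.
  tree-induced : Tree a b c → Joins e x y → Moves a b c x → Moves a b c y → e ≈ a ⊎ e ≈ b ⊎ e ≈ c
  tree-induced {a} {b} {c} {e} {x} {y} (star {z} {u} {v} {w} j k l u≢v v≢w u≢w) f mx my =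
    go (star-vertices j k l mx) (star-vertices j k l my) f
    where
    go : ∀ {x y} → OneOf z u v w x → OneOf z u v w y → Joins e x y → e ≈ a ⊎ e ≈ b ⊎ e ≈ c
    go 0th 0th f = contradiction refl (distinct f)
    go 1st 1st f = contradiction refl (distinct f)
    go 2nd 2nd f = contradiction refl (distinct f)
    go 3rd 3rd f = contradiction refl (distinct f)
    go 0th 1st f = inj₁ (parallel f j)
    go 1st 0th f = inj₁ (parallel (flip f) j)
    go 0th 2nd f = inj₂ (inj₁ (parallel f k))
    go 2nd 0th f = inj₂ (inj₁ (parallel (flip f) k))
    go 0th 3rd f = inj₂ (inj₂ (parallel f l))
    go 3rd 0th f = inj₂ (inj₂ (parallel (flip f) l))
    go 1st 2nd f = contradiction (flip k) (triangle-free j f)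
    go 2nd 1st f = contradiction (flip j) (triangle-free k f)
    go 1st 3rd f = contradiction (flip l) (triangle-free j f)
    go 3rd 1st f = contradiction (flip j) (triangle-free l f)
    go 2nd 3rd f = contradiction (flip l) (triangle-free k f)
    go 3rd 2nd f = contradiction (flip k) (triangle-free l f)
  tree-induced {a} {b} {c} {e} {x} {y} (path {u} {v} {w} {x′} j k l u≢w v≢x u≢x) f mx my =
    go (path-vertices j k l mx) (path-vertices j k l my) f
    where
    go : ∀ {x y} → OneOf u v w x′ x → OneOf u v w x′ y → Joins e x y → e ≈ a ⊎ e ≈ b ⊎ e ≈ c
    go 0th 0th f = contradiction refl (distinct f)
    go 1st 1st f = contradiction refl (distinct f)
    go 2nd 2nd f = contradiction refl (distinct f)
    go 3rd 3rd f = contradiction refl (distinct f)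
    go 0th 1st f = inj₁ (parallel f j)
    go 1st 0th f = inj₁ (parallel (flip f) j)
    go 1st 2nd f = inj₂ (inj₁ (parallel f k))
    go 2nd 1st f = inj₂ (inj₁ (parallel (flip f) k))
    go 2nd 3rd f = inj₂ (inj₂ (parallel f l))
    go 3rd 2nd f = inj₂ (inj₂ (parallel (flip f) l))
    go 0th 2nd f = contradiction (flip f) (triangle-free j k)
    go 2nd 0th f = contradiction f (triangle-free j k)
    go 1st 3rd f = contradiction (flip f) (triangle-free k l)
    go 3rd 1st f = contradiction f (triangle-free k l)
    go 0th 3rd f = contradiction (flip f) (square-free j k l u≢w v≢x)
    go 3rd 0th f = contradiction f (square-free j k l u≢w v≢x)

  Moves-product : a · b · c · u ≢ u → Moves a b c u
  Moves-product {a} {b} {c} {u} m with a · u ≟ u | b · u ≟ u | c · u ≟ u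
  ... | no au≢u  | _        | _        = inj₁ au≢u
  ... | yes _    | no bu≢u  | _        = inj₂ (inj₁ bu≢u)
  ... | yes _    | yes _    | no cu≢u  = inj₂ (inj₂ cu≢u)
  ... | yes au≡u | yes bu≡u | yes cu≡u =
    contradiction (chain₃ {c} {b = b} {c = a} (maps cu≡u) (maps bu≡u) (maps au≡u)) m

  -- Closed walks of length six.

  -- The field `closed` is the relation that the product of all six letters is trivial, split into
  -- halves. It is invariant under cyclic shifts, whence `rotate`.
  record Hexagon (a₁ a₂ a₃ a₄ a₅ a₆ : Permutation′ n) : Set p where
    field
      ∈₁  : member a₁
      ∈₂  : member a₂
      ∈₃  : member a₃
      ∈₄  : member a₄
      ∈₅  : member a₅
      ∈₆  : member a₆
      l₁₂ : Linked a₁ a₂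
      l₂₃ : Linked a₂ a₃
      l₃₄ : Linked a₃ a₄
      l₄₅ : Linked a₄ a₅
      l₅₆ : Linked a₅ a₆
      l₆₁ : Linked a₆ a₁
      closed : ∀ u → a₁ · a₂ · a₃ · u ≡ a₆ · a₅ · a₄ · u

  rotate : Hexagon a₁ a₂ a₃ a₄ a₅ a₆ → Hexagon a₂ a₃ a₄ a₅ a₆ a₁
  rotate {a₁} {a₂} {a₃} {a₄} {a₅} {a₆} H = record
    { ∈₁ = ∈₂ ; ∈₂ = ∈₃ ; ∈₃ = ∈₄ ; ∈₄ = ∈₅ ; ∈₅ = ∈₆ ; ∈₆ = ∈₁
    ; l₁₂ = l₂₃ ; l₂₃ = l₃₄ ; l₃₄ = l₄₅ ; l₄₅ = l₅₆ ; l₅₆ = l₆₁ ; l₆₁ = l₁₂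
    ; closed = λ u → ·-injective a₁ (trans (closed (a₄ · u))
        (trans (cong (λ x → a₆ · a₅ · x) (involution ∈₄ u)) (sym (involution ∈₁ (a₆ · a₅ · u)))))
    }
    where open Hexagon H

  -- The product of `a₁`, `a₂`, `a₃` is now a conjugate of `a₂`, hence an involution. If `a₄` and
  -- `a₆` differed, the other half would be a 4-cycle on a tree, whose square is not trivial. So
  -- both halves are conjugate transpositions, and comparing the points they swap yields the rest.
  alternating : Hexagon a₁ a₂ a₃ a₄ a₅ a₆ → a₁ ≈ a₃ → a₂ ≈ a₄ × a₄ ≈ a₆ × a₅ ≈ a₁
  alternating {a₁} {a₂} {a₃} {a₄} {a₅} {a₆} H a₁≈a₃ =
    let a₂≈a₆ , a₅≈a₁ = conclusion l₁₂ (Linked-sym l₅₆)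
    in (λ u → trans (a₂≈a₆ u) (sym (a₄≈a₆ u))) , a₄≈a₆ , a₅≈a₁
    where
    open Hexagon H

    a₁a₃ : ∀ u → a₁ · a₃ · u ≡ u
    a₁a₃ u = trans (a₁≈a₃ (a₃ · u)) (involution ∈₃ u)

    a₃a₁ : ∀ u → a₃ · a₁ · u ≡ u
    a₃a₁ u = trans (sym (a₁≈a₃ (a₁ · u))) (involution ∈₁ u)

    square≡1 : ∀ u → a₆ · a₅ · a₄ · a₆ · a₅ · a₄ · u ≡ u
    square≡1 u = trans (cong (λ x → a₆ · a₅ · a₄ · x) (sym (closed u)))
      (trans (sym (closed (a₁ · a₂ · a₃ · u)))
      (trans (cong (λ x → a₁ · a₂ · x) (a₃a₁ (a₂ · a₃ · u)))
      (trans (cong (a₁ ·_) (involution ∈₂ (a₃ · u))) (a₁a₃ u))))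

    a₄≈a₆ : a₄ ≈ a₆
    a₄≈a₆ = decidable-stable (a₄ ≈? a₆) (λ a₄≉a₆ →
      let (u , _ , j) = some-edge ∈₄
      in tree-square-moves (tree (Linked-sym l₅₆) (Linked-sym l₄₅) (λ a₆≈a₄ → a₄≉a₆ (λ u → sym (a₆≈a₄ u))))
           (inj₂ (inj₂ (moves j))) (square≡1 u))

    -- Both a₁a₂a₃ and a₆a₅a₄ are transpositions; they swap
    -- q, r and u, v respectively.

    conclusion : Linked a₁ a₂ → Linked a₆ a₅ → a₂ ≈ a₆ × a₅ ≈ a₁
    conclusion (linked {z} {q} {r} a₁z a₂z q≢r) (linked {y} {u} {v} a₆y a₅y u≢v) =
      cases (only a₅y a₅-moves)
      where
      -- The left half sends `q` to `r`, and the right half is `a₅` conjugated by `a₆`. Hence `a₅`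
      -- takes `a₆ · q` to `a₆ · r`, and `a₆ · q` is one of its ends `y` and `v`.
      q↦r : a₅ · a₆ · q ≡ a₆ · r
      q↦r = ·-injective a₆ (trans (cong (λ x → a₆ · a₅ · x) (sym (a₄≈a₆ q)))
        (trans (sym (closed q))
        (trans (chain₃ {a₃} (maps (trans (sym (a₁≈a₃ q)) (image (back a₁z)))) (forth a₂z)
                 (fixes a₁z (≢-sym (distinct a₂z)) (≢-sym q≢r)))
        (sym (involution ∈₆ r)))))

      a₅-moves : a₅ · a₆ · q ≢ a₆ · q
      a₅-moves eq = q≢r (·-injective a₆ (trans (sym eq) q↦r))

      a₆v : a₆ ∶ v ↦ v
      a₆v = fixes a₆y (≢-sym (distinct a₅y)) (≢-sym u≢v)

      cases : a₆ · q ≡ y ⊎ a₆ · q ≡ v → a₂ ≈ a₆ × a₅ ≈ a₁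
      cases (inj₁ a₆q≡y) = cases₁ q≡u r≡v
        where
        q≡u : q ≡ u
        q≡u = ·-injective a₆ (trans a₆q≡y (sym (image (back a₆y))))
        r≡v : r ≡ v
        r≡v = ·-injective a₆ (trans (sym q↦r)
          (trans (chain₂ {a₆} (maps a₆q≡y) (forth a₅y)) (sym (image a₆v))))
        cases₁ : q ≡ u → r ≡ v → a₂ ≈ a₆ × a₅ ≈ a₁
        -- The edges `a₁`, `a₆`, `a₅`, `a₂` run through `z`, `q`, `y`, `r` back to `z`. This is a
        -- 4-cycle unless `z` is `y`, and then the linked letters `a₆` and `a₁` would be equal.
        cases₁ refl refl with z ≟ y
        ... | yes refl = contradiction (parallel a₆y a₁z) (Linked⇒≉ l₆₁)
        ... | no z≢y   = contradiction (flip a₂z) (square-free a₁z (flip a₆y) a₅y z≢y q≢r)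
      cases (inj₂ a₆q≡v) = cases₂ q≡v r≡u
        where
        q≡v : q ≡ v
        q≡v = ·-injective a₆ (trans a₆q≡v (sym (image a₆v)))
        r≡u : r ≡ u
        r≡u = ·-injective a₆ (trans (sym q↦r)
          (trans (chain₂ {a₆} (maps a₆q≡v) (back a₅y)) (sym (image (back a₆y)))))
        cases₂ : q ≡ v → r ≡ u → a₂ ≈ a₆ × a₅ ≈ a₁
        -- The same closed walk with `a₅` and `a₆` exchanged; here the degenerate case is the
        -- desired conclusion.
        cases₂ refl refl with z ≟ y
        ... | yes refl = parallel a₂z a₆y , parallel a₅y a₁z
        ... | no z≢y   = contradiction (flip a₂z) (square-free a₁z (flip a₅y) a₆y z≢y q≢r)

  -- With no two letters at distance two equal, a₁a₂a₃ is a 4-cycle and its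
  -- tree contains a₄, a₅, a₆, so these repeat a₁, a₂, a₃ and the square of
  -- the 4-cycle would be trivial.

  some-repetition : Hexagon a₁ a₂ a₃ a₄ a₅ a₆ →
    ¬ a₁ ≈ a₃ → ¬ a₂ ≈ a₄ → ¬ a₃ ≈ a₅ → ¬ ¬ a₄ ≈ a₆
  some-repetition {a₁} {a₂} {a₃} {a₄} {a₅} {a₆} H a₁≉a₃ a₂≉a₄ a₃≉a₅ a₄≉a₆ =
    let (u , _ , j) = some-edge ∈₁
    in tree-square-moves T (inj₁ (moves j)) (square≡1 u)
    where
    open Hexagon H

    T : Tree a₁ a₂ a₃
    T = tree l₁₂ l₂₃ a₁≉a₃

    T′ : Tree a₆ a₅ a₄
    T′ = tree (Linked-sym l₅₆) (Linked-sym l₄₅) (λ a₆≈a₄ → a₄≉a₆ (λ u → sym (a₆≈a₄ u)))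

    transfer : Moves a₆ a₅ a₄ u → Moves a₁ a₂ a₃ u
    -- If the left half fixed `u`, then by `closed` so would the right half and its square, against
    -- `tree-square-moves` for `T′`.
    transfer {u} m = Moves-product {a₁} {a₂} {a₃} (λ eq →
      let eq′ = trans (sym (closed u)) eq
      in tree-square-moves T′ m (trans (cong (λ x → a₆ · a₅ · a₄ · x) eq′) eq′))

    a₄-old : a₄ ≈ a₁ ⊎ a₄ ≈ a₂ ⊎ a₄ ≈ a₃
    a₄-old = let (_ , _ , j) = some-edge ∈₄ in tree-induced T j
      (transfer (inj₂ (inj₂ (moves j)))) (transfer (inj₂ (inj₂ (moves (flip j)))))

    a₅-old : a₅ ≈ a₁ ⊎ a₅ ≈ a₂ ⊎ a₅ ≈ a₃
    a₅-old = let (_ , _ , j) = some-edge ∈₅ in tree-induced T j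
      (transfer (inj₂ (inj₁ (moves j)))) (transfer (inj₂ (inj₁ (moves (flip j)))))

    a₆-old : a₆ ≈ a₁ ⊎ a₆ ≈ a₂ ⊎ a₆ ≈ a₃
    a₆-old = let (_ , _ , j) = some-edge ∈₆ in tree-induced T j
      (transfer (inj₁ (moves j))) (transfer (inj₁ (moves (flip j))))

    -- Linked letters differ, and letters at distance two differ by assumption. Taken in this order,
    -- each of `a₄`, `a₅`, `a₆` has just one candidate left.
    a₄≈a₁ : a₄ ≈ a₁
    a₄≈a₁ with a₄-old
    ... | inj₁ eq        = eq
    ... | inj₂ (inj₁ eq) = contradiction (λ u → sym (eq u)) a₂≉a₄
    ... | inj₂ (inj₂ eq) = contradiction eq (Linked⇒≉ (Linked-sym l₃₄))

    a₅≈a₂ : a₅ ≈ a₂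
    a₅≈a₂ with a₅-old
    ... | inj₁ eq        = contradiction (λ u → trans (a₄≈a₁ u) (sym (eq u))) (Linked⇒≉ l₄₅)
    ... | inj₂ (inj₁ eq) = eq
    ... | inj₂ (inj₂ eq) = contradiction (λ u → sym (eq u)) a₃≉a₅

    a₆≈a₃ : a₆ ≈ a₃
    a₆≈a₃ with a₆-old
    ... | inj₁ eq        = contradiction (λ u → trans (a₄≈a₁ u) (sym (eq u))) a₄≉a₆
    ... | inj₂ (inj₁ eq) = contradiction (λ u → trans (a₅≈a₂ u) (sym (eq u))) (Linked⇒≉ l₅₆)
    ... | inj₂ (inj₂ eq) = eq

    -- The 4-cycle would equal the product of its edges in reverse order, which is its own inverse.
    reversed : ∀ u → a₁ · a₂ · a₃ · u ≡ a₃ · a₂ · a₁ · u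
    reversed u = trans (closed u) (trans (a₆≈a₃ (a₅ · a₄ · u))
      (cong (a₃ ·_) (trans (a₅≈a₂ (a₄ · u)) (cong (a₂ ·_) (a₄≈a₁ u)))))

    square≡1 : ∀ u → a₁ · a₂ · a₃ · a₁ · a₂ · a₃ · u ≡ u
    square≡1 u = trans (cong (λ x → a₁ · a₂ · a₃ · x) (reversed u))
      (trans (cong (λ x → a₁ · a₂ · x) (involution ∈₃ (a₂ · a₁ · u)))
      (trans (cong (a₁ ·_) (involution ∈₂ (a₁ · u))) (involution ∈₁ u)))

  -- By `some-repetition` one of the four tests succeeds. Rotating the equal pair to the front,
  -- `alternating` shows that the whole word alternates between two letters.
  hexagon-opposite : Hexagon a₁ a₂ a₃ a₄ a₅ a₆ → a₂ ≈ a₆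
  hexagon-opposite {a₁} {a₂} {a₃} {a₄} {a₅} {a₆} H
    with a₁ ≈? a₃ | a₂ ≈? a₄ | a₃ ≈? a₅ | a₄ ≈? a₆
  ... | yes eq | _ | _ | _ =
    let (a₂≈a₄ , a₄≈a₆ , _) = alternating H eq in λ u → trans (a₂≈a₄ u) (a₄≈a₆ u)
  ... | no _ | yes eq | _ | _ =
    let (_ , _ , a₆≈a₂) = alternating (rotate H) eq in λ u → sym (a₆≈a₂ u)
  ... | no _ | no _ | yes eq | _ =
    let (_ , a₆≈a₂ , _) = alternating (rotate (rotate H)) eq in λ u → sym (a₆≈a₂ u)
  ... | no _ | no _ | no _ | yes eq =
    let (_ , _ , a₂≈a₄) = alternating (rotate (rotate (rotate H))) eq in λ u → trans (a₂≈a₄ u) (eq u)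
  ... | no ¬₁₃ | no ¬₂₄ | no ¬₃₅ | no ¬₄₆ = contradiction ¬₄₆ (some-repetition H ¬₁₃ ¬₂₄ ¬₃₅)

-- The girth hypothesis and the conclusion.

HasGirth⇒≤ : ∀ {c ℓ e} {V} {Γ : SimpleGraph {c} {ℓ} V e} {g k m} →
  HasGirth Γ g → [ k ] ≤∞ g → Cycle Γ m → k ≤ m
HasGirth⇒≤ (finite _ shortest) [ k≤g ]≤ C = ≤-trans k≤g (shortest C)
HasGirth⇒≤ (infinite acyclic)  _        C = contradiction C acyclic

theorem1 : ∀ {p} (n : ℕ) → 3 ≤ n →
    (S : TranspositionSet n p) →
    Generates (Sₙ n) (TranspositionSet.member S) →
    (g : ℕ ⁺) → HasGirth (transpositionGraph S) g → [ 5 ] ≤∞ g →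
    IsInternalSemidirectProduct
    (Sym (Group.setoid (Sₙ n)))
    (Aut (Cay (Sₙ n) (connectionSet S)))
    (RightRegular (Sₙ n))
    (AutFixing (Sₙ n) (TranspositionSet.member S))
theorem1 n _ S generates g hasGirth 5≤g =
  isInternalSemidirectProduct generates
    (labelsLocallyConstant _≈?_
      (λ {s} → involution {s})
      (λ {s} {t} {c} {d} → square {s} {t} {c} {d})
      (λ {s} {t} s∈S t∈S st≉ts → braid (noncommuting⇒Linked {s} {t} s∈S t∈S st≉ts))
      (λ {a₁} {a₂} {a₃} {a₄} {a₅} {a₆} ∈₁ ∈₂ ∈₃ ∈₄ ∈₅ ∈₆ ¬₁₂ ¬₂₃ ¬₃₄ ¬₄₅ ¬₅₆ ¬₆₁ closed →
        hexagon-opposite {a₁} {a₂} {a₃} {a₄} {a₅} {a₆} record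
          { ∈₁ = ∈₁ ; ∈₂ = ∈₂ ; ∈₃ = ∈₃ ; ∈₄ = ∈₄ ; ∈₅ = ∈₅ ; ∈₆ = ∈₆
          ; l₁₂ = noncommuting⇒Linked ∈₁ ∈₂ ¬₁₂
          ; l₂₃ = noncommuting⇒Linked ∈₂ ∈₃ ¬₂₃
          ; l₃₄ = noncommuting⇒Linked ∈₃ ∈₄ ¬₃₄
          ; l₄₅ = noncommuting⇒Linked ∈₄ ∈₅ ¬₄₅
          ; l₅₆ = noncommuting⇒Linked ∈₅ ∈₆ ¬₅₆
          ; l₆₁ = noncommuting⇒Linked ∈₆ ∈₁ ¬₆₁
          -- Since `a₃ ∙ (a₂ ∙ a₁)` applies `a₃` first, the hypothesis of `hexagon` unfolds to
          -- exactly this field.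
          ; closed = closed
          }))
  where
  open CayleyGraph (Sₙ n) (connectionSet S)
  open TranspositionProducts S (HasGirth⇒≤ hasGirth 5≤g)
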